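{- Let $G\cong\mathbb Z/2\mathbb Z\times\mathbb Z/2\mathbb Z$ with generators $\sigma_1,\sigma_2$, and let $M$ be a $\mathbb Z[G]$-module, written multiplicatively, such that $(M,\sigma_1,\sigma_2)$ satisfies QH90. Then \[\ker(1-\sigma_1)(1-\sigma_2)=\ker(1-\sigma_1)\cdot\ker(1-\sigma_2)\] if and only if the following holds: for all $m_1,m_2\in M$ satisfying (1) $(1+\sigma_1)\cdot m_1=1=(1+\sigma_2)\cdot m_2$ and (2) $m_1\,\sigma_1(m_2)=m_2\,\sigma_2(m_1)$, there exists $n\in M$ with $m_i=(1-\sigma_i)\cdot n$ for $i=1,2$.
   Context: The module action is written multiplicatively: for $c_g\in\mathbb Z$, $(\sum_g c_g g)\cdot m=\prod_g g(m)^{c_g}$; e.g. $(1+\sigma_i)\cdot m=m\,\sigma_i(m)$ and $(1-\sigma_i)\cdot m=m/\sigma_i(m)$, where $1$ denotes the identity of $G$ (as an element of $\mathbb Z[G]$), and the identity of $M$ is also written $1$. For $x\in\mathbb Z[G]$, $\ker x=\{m\in M: x\cdot m=1\}$. For subsets $A,B\subseteq M$, $A\cdot B=\{ab:a\in A,b\in B\}$. $(M,\sigma_1,\sigma_2)$ satisfies QH90 means: for each $i\in\{1,2\}$ and $m\in M$, if $(1+\sigma_i)\cdot m=1$ then there exists $n\in M$ with $m=(1-\sigma_i)\cdot n$. -}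

module Defs where

open import Algebra.Bundles using (Group; Ring)
open import Algebra.Construct.DirectProduct using () renaming (group to _×-group_)
open import Algebra.Module.Bundles using (LeftModule)
open import Algebra.Morphism.Structures using (module GroupMorphisms)
open import Data.Bool.Base using (if_then_else_)
open import Data.Integer.Base as ℤ using (ℤ; 0ℤ; 1ℤ)
open import Data.List.Base using (List; []; _∷_; _++_; map)
open import Data.Parity.Base using (Parity)
open import Data.Product.Base using (_×_; _,_; proj₁; proj₂; ∃₂; ∃-syntax)
open import Level using (Level; _⊔_; 0ℓ)
open import Relation.Binary.Definitions using (Decidable)
open import Relation.Binary.PropositionalEquality using (_≡_; refl; sym; trans; cong; cong₂; module ≡-Reasoning)
open import Relation.Nullary.Decidable using (yes; no; does; map′; _×-dec_)
open import Relation.Nullary.Negation using (contradiction)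
open import Relation.Unary using (Pred)
import Algebra.Properties.Group as GroupProperties
import Data.Integer.Properties as ℤ
import Data.Parity.Properties as ℙ

private
  variable
    c ℓ m ℓm p q : Level

-- The integral group ring ℤ[G].  Elements are finite formal sums Σ cᵢ gᵢ, kept
-- as lists of pairs (cᵢ , gᵢ) with repetitions allowed; two formal sums are
-- equal when every g ∈ G has the same total coefficient in both.

module GroupRing (G : Group c ℓ) (_≟_ : Decidable (Group._≈_ G)) where

  open Group G using (_≈_; _∙_; ε; _⁻¹) renaming (Carrier to ∣G∣)

  FormalSum : Set c
  FormalSum = List (ℤ × ∣G∣)

  term : ℤ → ∣G∣ → ∣G∣ → ℤ
  term a h g = if does (h ≟ g) then a else 0ℤ

  coeff : FormalSum → ∣G∣ → ℤ
  coeff []            g = 0ℤ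
  coeff ((a , h) ∷ x) g = term a h g ℤ.+ coeff x g

  infix 4 _≋_

  record _≋_ (x y : FormalSum) : Set c where
    constructor mk≋
    field
      coeff-≡ : ∀ g → coeff x g ≡ coeff y g

  open _≋_ public

  negate : FormalSum → FormalSum
  negate = map λ (a , h) → (ℤ.- a , h)

  translate : ℤ → ∣G∣ → FormalSum → FormalSum
  translate a h = map λ (b , k) → (a ℤ.* b , h ∙ k)

  infixl 7 _⊛_

  _⊛_ : FormalSum → FormalSum → FormalSum
  []            ⊛ y = []
  ((a , h) ∷ x) ⊛ y = translate a h y ++ x ⊛ y

  [_] : ∣G∣ → FormalSum
  [ g ] = (1ℤ , g) ∷ []

  private
    module G where
      open Group G public
      open GroupProperties G public

    open ≡-Reasoning

    +-swap : ∀ a b d e → (a ℤ.+ b) ℤ.+ (d ℤ.+ e) ≡ (a ℤ.+ d) ℤ.+ (b ℤ.+ e)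
    +-swap a b d e = begin
      (a ℤ.+ b) ℤ.+ (d ℤ.+ e)  ≡⟨ ℤ.+-assoc a b (d ℤ.+ e) ⟩
      a ℤ.+ (b ℤ.+ (d ℤ.+ e))  ≡⟨ cong (ℤ._+_ a) (ℤ.+-assoc b d e) ⟨
      a ℤ.+ ((b ℤ.+ d) ℤ.+ e)  ≡⟨ cong (λ t → a ℤ.+ (t ℤ.+ e)) (ℤ.+-comm b d) ⟩
      a ℤ.+ ((d ℤ.+ b) ℤ.+ e)  ≡⟨ cong (ℤ._+_ a) (ℤ.+-assoc d b e) ⟩
      a ℤ.+ (d ℤ.+ (b ℤ.+ e))  ≡⟨ ℤ.+-assoc a d (b ℤ.+ e) ⟨
      (a ℤ.+ d) ℤ.+ (b ℤ.+ e)  ∎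

    term-⇔ : ∀ a {h g h′ g′} → (h ≈ g → h′ ≈ g′) → (h′ ≈ g′ → h ≈ g) →
             term a h g ≡ term a h′ g′
    term-⇔ a {h} {g} {h′} {g′} to from with h ≟ g | h′ ≟ g′
    ... | yes _   | yes _   = refl
    ... | yes h≈g | no ¬p   = contradiction (to h≈g) ¬p
    ... | no ¬p   | yes h≈g = contradiction (from h≈g) ¬p
    ... | no _    | no _    = refl

    term-* : ∀ a b h g → term (a ℤ.* b) h g ≡ a ℤ.* term b h g
    term-* a b h g with h ≟ g
    ... | yes _ = refl
    ... | no  _ = sym (ℤ.*-zeroʳ a)

    term-neg : ∀ a h g → term (ℤ.- a) h g ≡ ℤ.- term a h g
    term-neg a h g with h ≟ g
    ... | yes _ = refl
    ... | no  _ = refl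

    ∙-moveˡ : ∀ {h k g} → h ∙ k ≈ g → k ≈ h ⁻¹ ∙ g
    ∙-moveˡ {h} {k} hk≈g = G.trans (G.sym (G.\\-leftDividesʳ h k)) (G.∙-congˡ hk≈g)

    ∙-moveˡ⁻ : ∀ {h k g} → k ≈ h ⁻¹ ∙ g → h ∙ k ≈ g
    ∙-moveˡ⁻ {h} {k} {g} e = G.trans (G.∙-congˡ e) (G.\\-leftDividesˡ h g)

    ∙-moveʳ : ∀ {h k g} → h ∙ k ≈ g → h ≈ g ∙ k ⁻¹
    ∙-moveʳ {h} {k} hk≈g = G.trans (G.sym (G.//-rightDividesʳ k h)) (G.∙-congʳ hk≈g)

    ∙-moveʳ⁻ : ∀ {h k g} → h ≈ g ∙ k ⁻¹ → h ∙ k ≈ g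
    ∙-moveʳ⁻ {h} {k} {g} e = G.trans (G.∙-congʳ e) (G.//-rightDividesˡ k g)

    coeff-cong : ∀ x {g g′} → g ≈ g′ → coeff x g ≡ coeff x g′
    coeff-cong []            e = refl
    coeff-cong ((a , h) ∷ x) e = cong₂ ℤ._+_
      (term-⇔ a (λ u → G.trans u e) (λ u → G.trans u (G.sym e)))
      (coeff-cong x e)

    coeff-++ : ∀ x y g → coeff (x ++ y) g ≡ coeff x g ℤ.+ coeff y g
    coeff-++ []            y g = sym (ℤ.+-identityˡ _)
    coeff-++ ((a , h) ∷ x) y g = trans
      (cong (ℤ._+_ (term a h g)) (coeff-++ x y g))
      (sym (ℤ.+-assoc (term a h g) _ _))

    coeff-negate : ∀ x g → coeff (negate x) g ≡ ℤ.- coeff x g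
    coeff-negate []            g = refl
    coeff-negate ((a , h) ∷ x) g = trans
      (cong₂ ℤ._+_ (term-neg a h g) (coeff-negate x g))
      (sym (ℤ.neg-distrib-+ (term a h g) _))

    coeff-translate : ∀ a h y g → coeff (translate a h y) g ≡ a ℤ.* coeff y (h ⁻¹ ∙ g)
    coeff-translate a h []            g = sym (ℤ.*-zeroʳ a)
    coeff-translate a h ((b , k) ∷ y) g = begin
      term (a ℤ.* b) (h ∙ k) g ℤ.+ coeff (translate a h y) g
        ≡⟨ cong₂ ℤ._+_ (trans (term-* a b (h ∙ k) g)
                              (cong (a ℤ.*_) (term-⇔ b ∙-moveˡ ∙-moveˡ⁻)))
                       (coeff-translate a h y g) ⟩
      a ℤ.* term b k (h ⁻¹ ∙ g) ℤ.+ a ℤ.* coeff y (h ⁻¹ ∙ g)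
        ≡⟨ ℤ.*-distribˡ-+ a _ _ ⟨
      a ℤ.* (term b k (h ⁻¹ ∙ g) ℤ.+ coeff y (h ⁻¹ ∙ g)) ∎

    coeff-∷⊛ : ∀ a h x y g →
      coeff (((a , h) ∷ x) ⊛ y) g ≡ a ℤ.* coeff y (h ⁻¹ ∙ g) ℤ.+ coeff (x ⊛ y) g
    coeff-∷⊛ a h x y g = trans
      (coeff-++ (translate a h y) (x ⊛ y) g)
      (cong (ℤ._+ coeff (x ⊛ y) g) (coeff-translate a h y g))

    coeff-⊛[] : ∀ x g → coeff (x ⊛ []) g ≡ 0ℤ
    coeff-⊛[] []      g = refl
    coeff-⊛[] (_ ∷ x) g = coeff-⊛[] x g

    coeff-⊛∷ : ∀ x b k y g →
      coeff (x ⊛ ((b , k) ∷ y)) g ≡ b ℤ.* coeff x (g ∙ k ⁻¹) ℤ.+ coeff (x ⊛ y) g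
    coeff-⊛∷ []            b k y g = sym (trans (ℤ.+-identityʳ _) (ℤ.*-zeroʳ b))
    coeff-⊛∷ ((a , h) ∷ x) b k y g = begin
      term (a ℤ.* b) (h ∙ k) g ℤ.+ coeff (translate a h y ++ x ⊛ ((b , k) ∷ y)) g
        ≡⟨ cong₂ ℤ._+_
             (trans (cong (λ t → term t (h ∙ k) g) (ℤ.*-comm a b))
                    (trans (term-* b a (h ∙ k) g)
                           (cong (b ℤ.*_) (term-⇔ a ∙-moveʳ ∙-moveʳ⁻))))
             (trans (coeff-++ (translate a h y) _ g)
                    (trans (cong (ℤ._+_ T) (coeff-⊛∷ x b k y g))
                           (trans (sym (ℤ.+-assoc T B R))
                                  (trans (cong (ℤ._+ R) (ℤ.+-comm T B))
                                         (ℤ.+-assoc B T R))))) ⟩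
      b ℤ.* term a h (g ∙ k ⁻¹) ℤ.+ (b ℤ.* coeff x (g ∙ k ⁻¹) ℤ.+ (T ℤ.+ R))
        ≡⟨ ℤ.+-assoc (b ℤ.* term a h (g ∙ k ⁻¹)) _ _ ⟨
      (b ℤ.* term a h (g ∙ k ⁻¹) ℤ.+ b ℤ.* coeff x (g ∙ k ⁻¹)) ℤ.+ (T ℤ.+ R)
        ≡⟨ cong₂ ℤ._+_ (ℤ.*-distribˡ-+ b _ _) (coeff-++ (translate a h y) (x ⊛ y) g) ⟨
      b ℤ.* (term a h (g ∙ k ⁻¹) ℤ.+ coeff x (g ∙ k ⁻¹))
        ℤ.+ coeff (translate a h y ++ x ⊛ y) g ∎
      where
      T = coeff (translate a h y) g
      R = coeff (x ⊛ y) g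
      B = b ℤ.* coeff x (g ∙ k ⁻¹)

    ⊛-congˡ : ∀ x {y y′} → y ≋ y′ → ∀ g → coeff (x ⊛ y) g ≡ coeff (x ⊛ y′) g
    ⊛-congˡ []            e g = refl
    ⊛-congˡ ((a , h) ∷ x) {y} {y′} e g = begin
      coeff (((a , h) ∷ x) ⊛ y) g
        ≡⟨ coeff-∷⊛ a h x y g ⟩
      a ℤ.* coeff y (h ⁻¹ ∙ g) ℤ.+ coeff (x ⊛ y) g
        ≡⟨ cong₂ ℤ._+_ (cong (a ℤ.*_) (coeff-≡ e _)) (⊛-congˡ x e g) ⟩
      a ℤ.* coeff y′ (h ⁻¹ ∙ g) ℤ.+ coeff (x ⊛ y′) g
        ≡⟨ coeff-∷⊛ a h x y′ g ⟨
      coeff (((a , h) ∷ x) ⊛ y′) g ∎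

    ⊛-congʳ : ∀ y {x x′} → x ≋ x′ → ∀ g → coeff (x ⊛ y) g ≡ coeff (x′ ⊛ y) g
    ⊛-congʳ [] {x} {x′} e g = trans (coeff-⊛[] x g) (sym (coeff-⊛[] x′ g))
    ⊛-congʳ ((b , k) ∷ y) {x} {x′} e g = begin
      coeff (x ⊛ ((b , k) ∷ y)) g
        ≡⟨ coeff-⊛∷ x b k y g ⟩
      b ℤ.* coeff x (g ∙ k ⁻¹) ℤ.+ coeff (x ⊛ y) g
        ≡⟨ cong₂ ℤ._+_ (cong (b ℤ.*_) (coeff-≡ e _)) (⊛-congʳ y e g) ⟩
      b ℤ.* coeff x′ (g ∙ k ⁻¹) ℤ.+ coeff (x′ ⊛ y) g
        ≡⟨ coeff-⊛∷ x′ b k y g ⟨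
      coeff (x′ ⊛ ((b , k) ∷ y)) g ∎

    ⊛-distribʳ : ∀ z x y g → coeff ((x ++ y) ⊛ z) g ≡ coeff (x ⊛ z) g ℤ.+ coeff (y ⊛ z) g
    ⊛-distribʳ z []            y g = sym (ℤ.+-identityˡ _)
    ⊛-distribʳ z ((a , h) ∷ x) y g = begin
      coeff (((a , h) ∷ (x ++ y)) ⊛ z) g
        ≡⟨ coeff-∷⊛ a h (x ++ y) z g ⟩
      Z ℤ.+ coeff ((x ++ y) ⊛ z) g
        ≡⟨ cong (ℤ._+_ Z) (⊛-distribʳ z x y g) ⟩
      Z ℤ.+ (coeff (x ⊛ z) g ℤ.+ coeff (y ⊛ z) g)
        ≡⟨ ℤ.+-assoc Z _ _ ⟨
      (Z ℤ.+ coeff (x ⊛ z) g) ℤ.+ coeff (y ⊛ z) g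
        ≡⟨ cong (ℤ._+ coeff (y ⊛ z) g) (coeff-∷⊛ a h x z g) ⟨
      coeff (((a , h) ∷ x) ⊛ z) g ℤ.+ coeff (y ⊛ z) g ∎
      where Z = a ℤ.* coeff z (h ⁻¹ ∙ g)

    ⊛-distribˡ : ∀ x y z g → coeff (x ⊛ (y ++ z)) g ≡ coeff (x ⊛ y) g ℤ.+ coeff (x ⊛ z) g
    ⊛-distribˡ []            y z g = refl
    ⊛-distribˡ ((a , h) ∷ x) y z g = begin
      coeff (((a , h) ∷ x) ⊛ (y ++ z)) g
        ≡⟨ coeff-∷⊛ a h x (y ++ z) g ⟩
      a ℤ.* coeff (y ++ z) (h ⁻¹ ∙ g) ℤ.+ coeff (x ⊛ (y ++ z)) g
        ≡⟨ cong₂ ℤ._+_ (trans (cong (a ℤ.*_) (coeff-++ y z _)) (ℤ.*-distribˡ-+ a _ _))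
                       (⊛-distribˡ x y z g) ⟩
      (a ℤ.* coeff y (h ⁻¹ ∙ g) ℤ.+ a ℤ.* coeff z (h ⁻¹ ∙ g))
        ℤ.+ (coeff (x ⊛ y) g ℤ.+ coeff (x ⊛ z) g)
        ≡⟨ +-swap (a ℤ.* coeff y (h ⁻¹ ∙ g)) _ _ _ ⟩
      (a ℤ.* coeff y (h ⁻¹ ∙ g) ℤ.+ coeff (x ⊛ y) g)
        ℤ.+ (a ℤ.* coeff z (h ⁻¹ ∙ g) ℤ.+ coeff (x ⊛ z) g)
        ≡⟨ cong₂ ℤ._+_ (coeff-∷⊛ a h x y g) (coeff-∷⊛ a h x z g) ⟨
      coeff (((a , h) ∷ x) ⊛ y) g ℤ.+ coeff (((a , h) ∷ x) ⊛ z) g ∎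

    translate-⊛ : ∀ a h y z g →
      coeff (translate a h y ⊛ z) g ≡ a ℤ.* coeff (y ⊛ z) (h ⁻¹ ∙ g)
    translate-⊛ a h []            z g = sym (ℤ.*-zeroʳ a)
    translate-⊛ a h ((b , k) ∷ y) z g = begin
      coeff (((a ℤ.* b , h ∙ k) ∷ translate a h y) ⊛ z) g
        ≡⟨ coeff-∷⊛ (a ℤ.* b) (h ∙ k) (translate a h y) z g ⟩
      (a ℤ.* b) ℤ.* coeff z ((h ∙ k) ⁻¹ ∙ g) ℤ.+ coeff (translate a h y ⊛ z) g
        ≡⟨ cong₂ ℤ._+_
             (trans (ℤ.*-assoc a b _)
                    (cong (λ t → a ℤ.* (b ℤ.* t))
                          (coeff-cong z (G.trans (G.∙-congʳ (G.⁻¹-anti-homo-∙ h k))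
                                                 (G.assoc (k ⁻¹) (h ⁻¹) g)))))
             (translate-⊛ a h y z g) ⟩
      a ℤ.* (b ℤ.* coeff z (k ⁻¹ ∙ (h ⁻¹ ∙ g))) ℤ.+ a ℤ.* coeff (y ⊛ z) (h ⁻¹ ∙ g)
        ≡⟨ ℤ.*-distribˡ-+ a _ _ ⟨
      a ℤ.* (b ℤ.* coeff z (k ⁻¹ ∙ (h ⁻¹ ∙ g)) ℤ.+ coeff (y ⊛ z) (h ⁻¹ ∙ g))
        ≡⟨ cong (a ℤ.*_) (coeff-∷⊛ b k y z (h ⁻¹ ∙ g)) ⟨
      a ℤ.* coeff (((b , k) ∷ y) ⊛ z) (h ⁻¹ ∙ g) ∎

    ⊛-assoc : ∀ x y z g → coeff ((x ⊛ y) ⊛ z) g ≡ coeff (x ⊛ (y ⊛ z)) g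
    ⊛-assoc []            y z g = refl
    ⊛-assoc ((a , h) ∷ x) y z g = begin
      coeff ((translate a h y ++ x ⊛ y) ⊛ z) g
        ≡⟨ ⊛-distribʳ z (translate a h y) (x ⊛ y) g ⟩
      coeff (translate a h y ⊛ z) g ℤ.+ coeff ((x ⊛ y) ⊛ z) g
        ≡⟨ cong₂ ℤ._+_ (translate-⊛ a h y z g) (⊛-assoc x y z g) ⟩
      a ℤ.* coeff (y ⊛ z) (h ⁻¹ ∙ g) ℤ.+ coeff (x ⊛ (y ⊛ z)) g
        ≡⟨ coeff-∷⊛ a h x (y ⊛ z) g ⟨
      coeff (((a , h) ∷ x) ⊛ (y ⊛ z)) g ∎

    ⊛-identityˡ : ∀ x g → coeff ([ ε ] ⊛ x) g ≡ coeff x g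
    ⊛-identityˡ x g = begin
      coeff ([ ε ] ⊛ x) g              ≡⟨ coeff-∷⊛ 1ℤ ε [] x g ⟩
      1ℤ ℤ.* coeff x (ε ⁻¹ ∙ g) ℤ.+ 0ℤ ≡⟨ ℤ.+-identityʳ _ ⟩
      1ℤ ℤ.* coeff x (ε ⁻¹ ∙ g)        ≡⟨ ℤ.*-identityˡ _ ⟩
      coeff x (ε ⁻¹ ∙ g)
        ≡⟨ coeff-cong x (G.trans (G.∙-congʳ G.ε⁻¹≈ε) (G.identityˡ g)) ⟩
      coeff x g                        ∎

    ⊛-identityʳ : ∀ x g → coeff (x ⊛ [ ε ]) g ≡ coeff x g
    ⊛-identityʳ x g = begin
      coeff (x ⊛ [ ε ]) g                                  ≡⟨ coeff-⊛∷ x 1ℤ ε [] g ⟩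
      1ℤ ℤ.* coeff x (g ∙ ε ⁻¹) ℤ.+ coeff (x ⊛ []) g       ≡⟨ cong₂ ℤ._+_ (ℤ.*-identityˡ (coeff x (g ∙ ε ⁻¹))) (coeff-⊛[] x g) ⟩
      coeff x (g ∙ ε ⁻¹) ℤ.+ 0ℤ                            ≡⟨ ℤ.+-identityʳ _ ⟩
      coeff x (g ∙ ε ⁻¹)
        ≡⟨ coeff-cong x (G.trans (G.∙-congˡ G.ε⁻¹≈ε) (G.identityʳ g)) ⟩
      coeff x g                                            ∎

    ++-cong : ∀ {x x′ y y′} → x ≋ x′ → y ≋ y′ → x ++ y ≋ x′ ++ y′
    ++-cong {x} {x′} {y} {y′} e f = mk≋ λ g → begin
      coeff (x ++ y) g            ≡⟨ coeff-++ x y g ⟩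
      coeff x g ℤ.+ coeff y g     ≡⟨ cong₂ ℤ._+_ (coeff-≡ e g) (coeff-≡ f g) ⟩
      coeff x′ g ℤ.+ coeff y′ g   ≡⟨ coeff-++ x′ y′ g ⟨
      coeff (x′ ++ y′) g          ∎

    ++-assoc : ∀ x y z → (x ++ y) ++ z ≋ x ++ (y ++ z)
    ++-assoc x y z = mk≋ λ g → begin
      coeff ((x ++ y) ++ z) g
        ≡⟨ trans (coeff-++ (x ++ y) z g) (cong (ℤ._+ coeff z g) (coeff-++ x y g)) ⟩
      (coeff x g ℤ.+ coeff y g) ℤ.+ coeff z g
        ≡⟨ ℤ.+-assoc (coeff x g) _ _ ⟩
      coeff x g ℤ.+ (coeff y g ℤ.+ coeff z g)
        ≡⟨ trans (coeff-++ x (y ++ z) g) (cong (ℤ._+_ (coeff x g)) (coeff-++ y z g)) ⟨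
      coeff (x ++ (y ++ z)) g ∎

    ++-comm : ∀ x y → x ++ y ≋ y ++ x
    ++-comm x y = mk≋ λ g → begin
      coeff (x ++ y) g          ≡⟨ coeff-++ x y g ⟩
      coeff x g ℤ.+ coeff y g   ≡⟨ ℤ.+-comm (coeff x g) _ ⟩
      coeff y g ℤ.+ coeff x g   ≡⟨ coeff-++ y x g ⟨
      coeff (y ++ x) g          ∎

    ++-inverseˡ : ∀ x → negate x ++ x ≋ []
    ++-inverseˡ x = mk≋ λ g → begin
      coeff (negate x ++ x) g            ≡⟨ coeff-++ (negate x) x g ⟩
      coeff (negate x) g ℤ.+ coeff x g   ≡⟨ cong (ℤ._+ coeff x g) (coeff-negate x g) ⟩
      ℤ.- coeff x g ℤ.+ coeff x g        ≡⟨ ℤ.+-inverseˡ (coeff x g) ⟩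
      0ℤ                                 ∎

    ≋-refl : ∀ {x} → x ≋ x
    ≋-refl = mk≋ λ _ → refl

    ≋-sym : ∀ {x y} → x ≋ y → y ≋ x
    ≋-sym e = mk≋ λ g → sym (coeff-≡ e g)

    ≋-trans : ∀ {x y z} → x ≋ y → y ≋ z → x ≋ z
    ≋-trans e f = mk≋ λ g → trans (coeff-≡ e g) (coeff-≡ f g)

    negate-cong : ∀ {x y} → x ≋ y → negate x ≋ negate y
    negate-cong {x} {y} e = mk≋ λ g → begin
      coeff (negate x) g   ≡⟨ coeff-negate x g ⟩
      ℤ.- coeff x g        ≡⟨ cong ℤ.-_ (coeff-≡ e g) ⟩
      ℤ.- coeff y g        ≡⟨ coeff-negate y g ⟨
      coeff (negate y) g   ∎

  groupRing : Ring c c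
  groupRing = record
    { Carrier = FormalSum
    ; _≈_     = _≋_
    ; _+_     = _++_
    ; _*_     = _⊛_
    ; -_      = negate
    ; 0#      = []
    ; 1#      = [ ε ]
    ; isRing  = record
      { +-isAbelianGroup = record
        { isGroup = record
          { isMonoid = record
            { isSemigroup = record
              { isMagma = record
                { isEquivalence = record
                  { refl = ≋-refl ; sym = ≋-sym ; trans = ≋-trans }
                ; ∙-cong = ++-cong
                }
              ; assoc = ++-assoc
              }
            ; identity = (λ _ → ≋-refl) , (λ x → ++-comm x [])
            }
          ; inverse = ++-inverseˡ
                    , (λ x → ≋-trans (++-comm x (negate x)) (++-inverseˡ x))
          ; ⁻¹-cong = negate-cong
          }
        ; comm = ++-comm
        }
      ; *-cong = λ {x} {x′} {y} {y′} e f → mk≋ λ g →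
          trans (⊛-congˡ x f g) (⊛-congʳ y′ e g)
      ; *-assoc = λ x y z → mk≋ (⊛-assoc x y z)
      ; *-identity = (λ x → mk≋ (⊛-identityˡ x)) , (λ x → mk≋ (⊛-identityʳ x))
      ; distrib =
          (λ x y z → mk≋ λ g → trans (⊛-distribˡ x y z g) (sym (coeff-++ (x ⊛ y) (x ⊛ z) g)))
        , (λ z x y → mk≋ λ g → trans (⊛-distribʳ z x y g) (sym (coeff-++ (x ⊛ z) (y ⊛ z) g)))
      }
    }

ℤ/2×ℤ/2 : Group 0ℓ 0ℓ
ℤ/2×ℤ/2 = ℙ.+-0-group ×-group ℙ.+-0-group

module _ (G : Group c ℓ) where

  open Group G

  data ⟨_,_⟩ (s t : Carrier) : Pred Carrier (c ⊔ ℓ) where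
    gen₁ : ⟨ s , t ⟩ s
    gen₂ : ⟨ s , t ⟩ t
    unit : ⟨ s , t ⟩ ε
    mult : ∀ {g h} → ⟨ s , t ⟩ g → ⟨ s , t ⟩ h → ⟨ s , t ⟩ (g ∙ h)
    inv  : ∀ {g} → ⟨ s , t ⟩ g → ⟨ s , t ⟩ (g ⁻¹)
    resp : ∀ {g h} → g ≈ h → ⟨ s , t ⟩ g → ⟨ s , t ⟩ h

  record IsKleinFour (σ₁ σ₂ : Carrier) : Set (c ⊔ ℓ) where
    open GroupMorphisms rawGroup (Group.rawGroup ℤ/2×ℤ/2)
    field
      φ         : Carrier → Parity × Parity
      φ-iso     : IsGroupIsomorphism φ
      generates : ∀ g → ⟨ σ₁ , σ₂ ⟩ g

    infix 4 _≟_

    _≟_ : Decidable _≈_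
    g ≟ h = map′ injective ⟦⟧-cong
      ((proj₁ (φ g) ℙ.≟ proj₁ (φ h)) ×-dec (proj₂ (φ g) ℙ.≟ proj₂ (φ h)))
      where open IsGroupIsomorphism φ-iso

    open GroupRing G _≟_ public using () renaming (groupRing to ℤ[G])

-- The library writes modules additively; here M is written multiplicatively, so
-- _∙ᴹ_, 1ᴹ are the library's _+ᴹ_, 0ᴹ, and _·_ is the scalar action _*ₗ_.

module MultiplicativeModule
  {G : Group c ℓ} {_≟_ : Decidable (Group._≈_ G)}
  (M : LeftModule (GroupRing.groupRing G _≟_) m ℓm) where

  open GroupRing G _≟_ public using ([_])
  open Ring (GroupRing.groupRing G _≟_) public
    using (_+_; _-_; _*_) renaming (Carrier to ∣ℤ[G]∣; 1# to 𝟙)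
  open LeftModule M public
    using (_≈ᴹ_) renaming (Carrierᴹ to ∣M∣; _+ᴹ_ to infixl 6 _∙ᴹ_; 0ᴹ to 1ᴹ; _*ₗ_ to infixr 7 _·_)

  infix 8 _⟨_⟩

  _⟨_⟩ : Group.Carrier G → ∣M∣ → ∣M∣
  g ⟨ x ⟩ = [ g ] · x

  ker : ∣ℤ[G]∣ → Pred ∣M∣ ℓm
  ker x n = x · n ≈ᴹ 1ᴹ

  infixl 7 _∙ˢ_

  _∙ˢ_ : Pred ∣M∣ p → Pred ∣M∣ q → Pred ∣M∣ (m ⊔ ℓm ⊔ p ⊔ q)
  (A ∙ˢ B) n = ∃₂ λ a b → A a × B b × n ≈ᴹ a ∙ᴹ b

  QH90 : (σ₁ σ₂ : Group.Carrier G) → Set (m ⊔ ℓm)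
  QH90 σ₁ σ₂ = Hilbert90 σ₁ × Hilbert90 σ₂
    where
    Hilbert90 : Group.Carrier G → Set (m ⊔ ℓm)
    Hilbert90 σ = ∀ x → (𝟙 + [ σ ]) · x ≈ᴹ 1ᴹ → ∃[ n ] x ≈ᴹ (𝟙 - [ σ ]) · n

{-# OPTIONS --safe #-}

-- Write the module additively, with Dᵢ = 1 − σᵢ.  Condition (2) says
-- D₂ m₁ = D₁ m₂.  If the kernel of D₁ D₂ splits and mᵢ = Dᵢ aᵢ by QH90, then
-- a₁ − a₂ lies in that kernel, so a₁ − a₂ = u + v with u ∈ ker D₁, v ∈ ker D₂,
-- and n = a₂ + v works.  Conversely, for x ∈ ker D₁ D₂ the pair (D₁ x , 0)
-- satisfies (1) and (2); the resulting n gives x = (x − n) + n.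

module Submission where

open import Defs
open import Algebra.Bundles using (AbelianGroup; Group; Ring)
open import Algebra.Module.Bundles using (LeftModule)
open import Algebra.Morphism.Structures using (module GroupMorphisms)
open import Data.Integer.Base using (0ℤ; 1ℤ)
open import Data.Product.Base using (_×_; _,_; ∃₂; ∃-syntax)
open import Function.Bundles using (_⇔_; mk⇔; module Equivalence)
open import Relation.Binary.Definitions using (Decidable)
open import Relation.Binary.PropositionalEquality using (_≡_; refl; cong)
open import Relation.Nullary.Decidable using (yes; no)
open import Relation.Nullary.Negation using (contradiction)
open import Relation.Unary using (_≐_)
import Algebra.Properties.AbelianGroup as AbelianGroupProperties
import Algebra.Properties.CommutativeSemigroup as CommutativeSemigroupProperties
import Algebra.Properties.Ring as RingProperties
import Data.Integer.Base as ℤ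
import Data.Parity.Properties as ℙ
import Relation.Binary.Reasoning.Setoid as SetoidReasoning

-- Rearranging differences in an abelian group.

module _ {a ℓ} (A : AbelianGroup a ℓ) where

  open AbelianGroup A
  open AbelianGroupProperties A
  open CommutativeSemigroupProperties commutativeSemigroup using (interchange)
  open SetoidReasoning setoid

  [w-z]-[y-x]≈[w∙x]-[y∙z] : ∀ w x y z → (w - z) - (y - x) ≈ (w ∙ x) - (y ∙ z)
  [w-z]-[y-x]≈[w∙x]-[y∙z] w x y z = begin
    (w - z) - (y - x)             ≈⟨ ∙-congˡ (⁻¹-anti-homo‿- y x) ⟩
    (w ∙ z ⁻¹) ∙ (x ∙ y ⁻¹)       ≈⟨ interchange w (z ⁻¹) x (y ⁻¹) ⟩
    (w ∙ x) ∙ (z ⁻¹ ∙ y ⁻¹)       ≈⟨ ∙-congˡ (⁻¹-anti-homo-∙ y z) ⟨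
    (w ∙ x) - (y ∙ z)             ∎

  -- By the identity above, both equations say that one and the same element vanishes.
  w∙x≈y∙z⇔w-z≈y-x : ∀ w x y z → (w ∙ x ≈ y ∙ z) ⇔ (w - z ≈ y - x)
  w∙x≈y∙z⇔w-z≈y-x w x y z = mk⇔
    (λ e → x∙y⁻¹≈ε⇒x≈y _ _ (trans ([w-z]-[y-x]≈[w∙x]-[y∙z] w x y z) (x≈y⇒x∙y⁻¹≈ε e)))
    (λ e → x∙y⁻¹≈ε⇒x≈y _ _ (trans (sym ([w-z]-[y-x]≈[w∙x]-[y∙z] w x y z)) (x≈y⇒x∙y⁻¹≈ε e)))

-- Elements `1# - x` in a ring.

module _ {r ℓ} (R : Ring r ℓ) where

  open Ring R
  open RingProperties R
  open SetoidReasoning setoid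

  1-‿commutes : ∀ {x y} → x * y ≈ y * x → (1# - x) * y ≈ y * (1# - x)
  1-‿commutes {x} {y} xy≈yx = begin
    (1# - x) * y       ≈⟨ [y-z]x≈yx-zx y 1# x ⟩
    1# * y - x * y     ≈⟨ +-cong (trans (*-identityˡ y) (sym (*-identityʳ y))) (-‿cong xy≈yx) ⟩
    y * 1# - y * x     ≈⟨ x[y-z]≈xy-xz y 1# x ⟨
    y * (1# - x)       ∎

  -- The product telescopes to `1# - x * x`. It shows that every value of `1# - x` on a module
  -- satisfies the norm condition of QH90.
  involution⇒[1+x][1-x]≈0 : ∀ {x} → x * x ≈ 1# → (1# + x) * (1# - x) ≈ 0#
  involution⇒[1+x][1-x]≈0 {x} xx≈1 = begin
    (1# + x) * (1# - x)              ≈⟨ distribʳ (1# - x) 1# x ⟩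
    1# * (1# - x) + x * (1# - x)     ≈⟨ +-cong (*-identityˡ _) (x[y-z]≈xy-xz x 1# x) ⟩
    (1# - x) + (x * 1# - x * x)      ≈⟨ +-congˡ (+-cong (*-identityʳ x) (-‿cong xx≈1)) ⟩
    (1# - x) + (x - 1#)              ≈⟨ +-congˡ (⁻¹-anti-homo‿- 1# x) ⟨
    (1# - x) - (1# - x)              ≈⟨ -‿inverseʳ _ ⟩
    0#                               ∎

-- Kernels of differences on a module over an arbitrary ring.

module _ {r ℓ m ℓm} {R : Ring r ℓ} (M : LeftModule R m ℓm) where

  open Ring R
  open LeftModule M
  open AbelianGroup +ᴹ-abelianGroup using () renaming (_-_ to infixl 6 _-ᴹ_)
  open AbelianGroupProperties +ᴹ-abelianGroup
  open SetoidReasoning ≈ᴹ-setoid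

  -‿*ₗ : ∀ a x → (- a) *ₗ x ≈ᴹ -ᴹ (a *ₗ x)
  -‿*ₗ a x = inverseˡ-unique _ _ (begin
    (- a) *ₗ x +ᴹ a *ₗ x     ≈⟨ *ₗ-distribʳ x (- a) a ⟨
    (- a + a) *ₗ x           ≈⟨ *ₗ-congʳ (-‿inverseˡ a) ⟩
    0# *ₗ x                  ≈⟨ *ₗ-zeroˡ x ⟩
    0ᴹ                       ∎)

  *ₗ--ᴹ : ∀ a x → a *ₗ (-ᴹ x) ≈ᴹ -ᴹ (a *ₗ x)
  *ₗ--ᴹ a x = inverseˡ-unique _ _ (begin
    a *ₗ (-ᴹ x) +ᴹ a *ₗ x     ≈⟨ *ₗ-distribˡ a (-ᴹ x) x ⟨
    a *ₗ (-ᴹ x +ᴹ x)          ≈⟨ *ₗ-congˡ (-ᴹ‿inverseˡ x) ⟩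
    a *ₗ 0ᴹ                   ≈⟨ *ₗ-zeroʳ a ⟩
    0ᴹ                        ∎)

  [1-a]*ₗx≈x-a*ₗx : ∀ a x → (1# - a) *ₗ x ≈ᴹ x -ᴹ a *ₗ x
  [1-a]*ₗx≈x-a*ₗx a x = ≈ᴹ-trans (*ₗ-distribʳ x 1# (- a)) (+ᴹ-cong (*ₗ-identityˡ x) (-‿*ₗ a x))

  *ₗ-distribˡ-- : ∀ a x y → a *ₗ (x -ᴹ y) ≈ᴹ a *ₗ x -ᴹ a *ₗ y
  *ₗ-distribˡ-- a x y = ≈ᴹ-trans (*ₗ-distribˡ a x (-ᴹ y)) (+ᴹ-congˡ (*ₗ--ᴹ a y))

  a*ₗx≈a*ₗy⇒a*ₗ[x-y]≈0 : ∀ {a x y} → a *ₗ x ≈ᴹ a *ₗ y → a *ₗ (x -ᴹ y) ≈ᴹ 0ᴹ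
  a*ₗx≈a*ₗy⇒a*ₗ[x-y]≈0 e = ≈ᴹ-trans (*ₗ-distribˡ-- _ _ _) (x≈y⇒x∙y⁻¹≈ε e)

  *ₗ-absorbʳ : ∀ {a y} x → a *ₗ y ≈ᴹ 0ᴹ → a *ₗ (x +ᴹ y) ≈ᴹ a *ₗ x
  *ₗ-absorbʳ x ay≈0 = ≈ᴹ-trans (*ₗ-distribˡ _ x _) (≈ᴹ-trans (+ᴹ-congˡ ay≈0) (+ᴹ-identityʳ _))

  a*ₗx≈0⇒b*a*ₗx≈0 : ∀ {a x} b → a *ₗ x ≈ᴹ 0ᴹ → (b * a) *ₗ x ≈ᴹ 0ᴹ
  a*ₗx≈0⇒b*a*ₗx≈0 b ax≈0 = ≈ᴹ-trans (*ₗ-assoc b _ _) (≈ᴹ-trans (*ₗ-congˡ ax≈0) (*ₗ-zeroʳ b))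

  module _ {s t : Carrier} (ss≈1 : s * s ≈ 1#) (st≈ts : s * t ≈ t * s) where

    private
      Dₛ = 1# - s
      Dₜ = 1# - t

    differences-commute : Dₛ * Dₜ ≈ Dₜ * Dₛ
    -- The inner use commutes `s` with `Dₜ`, the outer one then `Dₛ` with `Dₜ`.
    differences-commute = 1-‿commutes R (sym (1-‿commutes R (sym st≈ts)))

    -- Moving `t *ₗ x` to the left and `s *ₗ y` to the right leaves a difference on each side.
    cocycle⇔differences-agree : ∀ x y →
      (x +ᴹ s *ₗ y ≈ᴹ y +ᴹ t *ₗ x) ⇔ (Dₜ *ₗ x ≈ᴹ Dₛ *ₗ y)
    cocycle⇔differences-agree x y = mk⇔
      (λ e → begin
        Dₜ *ₗ x          ≈⟨ [1-a]*ₗx≈x-a*ₗx t x ⟩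
        x -ᴹ t *ₗ x      ≈⟨ to e ⟩
        y -ᴹ s *ₗ y      ≈⟨ [1-a]*ₗx≈x-a*ₗx s y ⟨
        Dₛ *ₗ y          ∎)
      (λ e → from (begin
        x -ᴹ t *ₗ x      ≈⟨ [1-a]*ₗx≈x-a*ₗx t x ⟨
        Dₜ *ₗ x          ≈⟨ e ⟩
        Dₛ *ₗ y          ≈⟨ [1-a]*ₗx≈x-a*ₗx s y ⟩
        y -ᴹ s *ₗ y      ∎))
      where open Equivalence (w∙x≈y∙z⇔w-z≈y-x +ᴹ-abelianGroup x (s *ₗ y) y (t *ₗ x))

    KernelSplits : Set _
    KernelSplits =
      (λ x → (Dₛ * Dₜ) *ₗ x ≈ᴹ 0ᴹ) ≐
      (λ x → ∃₂ λ u v → Dₛ *ₗ u ≈ᴹ 0ᴹ × Dₜ *ₗ v ≈ᴹ 0ᴹ × x ≈ᴹ u +ᴹ v)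

    -- For the generators of the Klein four-group, `x` and `y` are the values of a 1-cocycle at `s`
    -- and `t`: the norm conditions come from the relations `s * s ≈ 1#` and `t * t ≈ 1#`, the third
    -- from `s * t ≈ t * s`. The conclusion makes it a coboundary, so this is the vanishing of the
    -- first cohomology group.
    CocyclesHavePreimage : Set _
    CocyclesHavePreimage = ∀ x y →
      (1# + s) *ₗ x ≈ᴹ 0ᴹ × (1# + t) *ₗ y ≈ᴹ 0ᴹ →
      x +ᴹ s *ₗ y ≈ᴹ y +ᴹ t *ₗ x →
      ∃[ n ] (x ≈ᴹ Dₛ *ₗ n × y ≈ᴹ Dₜ *ₗ n)

    kernelSplits⇔cocyclesHavePreimage :
      (∀ x → (1# + s) *ₗ x ≈ᴹ 0ᴹ → ∃[ n ] x ≈ᴹ Dₛ *ₗ n) →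
      (∀ x → (1# + t) *ₗ x ≈ᴹ 0ᴹ → ∃[ n ] x ≈ᴹ Dₜ *ₗ n) →
      KernelSplits ⇔ CocyclesHavePreimage
    kernelSplits⇔cocyclesHavePreimage hilbertₛ hilbertₜ = mk⇔ splits⇒preimage preimage⇒splits
      where
      splits⇒preimage : KernelSplits → CocyclesHavePreimage
      splits⇒preimage (⊆ , _) x y (Nx≈0 , Ny≈0) cocycle
        with a , x≈Da ← hilbertₛ x Nx≈0
           | b , y≈Db ← hilbertₜ y Ny≈0
        -- `Dₛ * Dₜ` sends `a` to `Dₜ *ₗ x` and `b` to `Dₛ *ₗ y`, which agree by the cocycle
        -- condition.
        with u , v , Du≈0 , Dv≈0 , a-b≈u+v ← ⊆ {a -ᴹ b} (a*ₗx≈a*ₗy⇒a*ₗ[x-y]≈0 (begin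
          (Dₛ * Dₜ) *ₗ a     ≈⟨ *ₗ-congʳ differences-commute ⟩
          (Dₜ * Dₛ) *ₗ a     ≈⟨ *ₗ-assoc Dₜ Dₛ a ⟩
          Dₜ *ₗ (Dₛ *ₗ a)    ≈⟨ *ₗ-congˡ x≈Da ⟨
          Dₜ *ₗ x            ≈⟨ Equivalence.to (cocycle⇔differences-agree x y) cocycle ⟩
          Dₛ *ₗ y            ≈⟨ *ₗ-congˡ y≈Db ⟩
          Dₛ *ₗ (Dₜ *ₗ b)    ≈⟨ *ₗ-assoc Dₛ Dₜ b ⟨
          (Dₛ * Dₜ) *ₗ b     ∎))
        -- Adding `v` does not change `Dₜ *ₗ b`, and `b +ᴹ v` differs from `a` only by `u`, which
        -- `Dₛ` kills.
        = b +ᴹ v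
        , (begin
            x                        ≈⟨ x≈Da ⟩
            Dₛ *ₗ a                  ≈⟨ *ₗ-congˡ a≈b+v+u ⟩
            Dₛ *ₗ (b +ᴹ v +ᴹ u)      ≈⟨ *ₗ-absorbʳ (b +ᴹ v) Du≈0 ⟩
            Dₛ *ₗ (b +ᴹ v)           ∎)
        , ≈ᴹ-trans y≈Db (≈ᴹ-sym (*ₗ-absorbʳ b Dv≈0))
        where
        a≈b+v+u : a ≈ᴹ b +ᴹ v +ᴹ u
        a≈b+v+u = begin
          a                   ≈⟨ //-rightDividesˡ b a ⟨
          (a -ᴹ b) +ᴹ b       ≈⟨ +ᴹ-congʳ a-b≈u+v ⟩
          (u +ᴹ v) +ᴹ b       ≈⟨ xy∙z≈zy∙x u v b ⟩
          b +ᴹ v +ᴹ u         ∎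
          where
          open CommutativeSemigroupProperties
            (AbelianGroup.commutativeSemigroup +ᴹ-abelianGroup) using (xy∙z≈zy∙x)

      preimage⇒splits : CocyclesHavePreimage → KernelSplits
      preimage⇒splits preimage = ⊆ , ⊇
        where
        ⊆ : ∀ {x} → (Dₛ * Dₜ) *ₗ x ≈ᴹ 0ᴹ →
            ∃₂ λ u v → Dₛ *ₗ u ≈ᴹ 0ᴹ × Dₜ *ₗ v ≈ᴹ 0ᴹ × x ≈ᴹ u +ᴹ v
        ⊆ {x} DDx≈0
          -- The second entry `0ᴹ` forces `n` into the kernel of `Dₜ`; the first forces `x -ᴹ n`
          -- into the kernel of `Dₛ`.
          with n , Dx≈Dn , 0≈Dn ← preimage (Dₛ *ₗ x) 0ᴹ
                 ( (begin
                     (1# + s) *ₗ (Dₛ *ₗ x)     ≈⟨ *ₗ-assoc (1# + s) Dₛ x ⟨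
                     ((1# + s) * Dₛ) *ₗ x      ≈⟨ *ₗ-congʳ (involution⇒[1+x][1-x]≈0 R ss≈1) ⟩
                     0# *ₗ x                   ≈⟨ *ₗ-zeroˡ x ⟩
                     0ᴹ                        ∎)
                 , *ₗ-zeroʳ (1# + t) )
                 (Equivalence.from (cocycle⇔differences-agree (Dₛ *ₗ x) 0ᴹ) (begin
                     Dₜ *ₗ (Dₛ *ₗ x)     ≈⟨ *ₗ-assoc Dₜ Dₛ x ⟨
                     (Dₜ * Dₛ) *ₗ x      ≈⟨ *ₗ-congʳ differences-commute ⟨
                     (Dₛ * Dₜ) *ₗ x      ≈⟨ DDx≈0 ⟩
                     0ᴹ                  ≈⟨ *ₗ-zeroʳ Dₛ ⟨
                     Dₛ *ₗ 0ᴹ            ∎))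
          = x -ᴹ n , n , a*ₗx≈a*ₗy⇒a*ₗ[x-y]≈0 Dx≈Dn , ≈ᴹ-sym 0≈Dn , ≈ᴹ-sym (//-rightDividesˡ n x)

        ⊇ : ∀ {x} → (∃₂ λ u v → Dₛ *ₗ u ≈ᴹ 0ᴹ × Dₜ *ₗ v ≈ᴹ 0ᴹ × x ≈ᴹ u +ᴹ v) →
            (Dₛ * Dₜ) *ₗ x ≈ᴹ 0ᴹ
        ⊇ {x} (u , v , Du≈0 , Dv≈0 , x≈u+v) = begin
          (Dₛ * Dₜ) *ₗ x             ≈⟨ *ₗ-congˡ x≈u+v ⟩
          (Dₛ * Dₜ) *ₗ (u +ᴹ v)      ≈⟨ *ₗ-absorbʳ u (a*ₗx≈0⇒b*a*ₗx≈0 Dₛ Dv≈0) ⟩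
          -- `Dₛ` kills `u`, so it has to act first.
          (Dₛ * Dₜ) *ₗ u             ≈⟨ *ₗ-congʳ differences-commute ⟩
          (Dₜ * Dₛ) *ₗ u             ≈⟨ a*ₗx≈0⇒b*a*ₗx≈0 Dₜ Du≈0 ⟩
          0ᴹ                         ∎

-- From relations in the Klein four-group to relations in its group ring.

module _ {c ℓ} (G : Group c ℓ) (_≟_ : Decidable (Group._≈_ G)) where

  open Group G using (_≈_; sym; trans)
  open GroupRing G _≟_

  -- Coefficients are found by testing equality in the group, and equal elements pass the same
  -- tests. This carries group relations over to the group ring.
  []-cong : ∀ {g h} → g ≈ h → [ g ] ≋ [ h ]
  []-cong {g} {h} g≈h = mk≋ λ k → cong (ℤ._+ 0ℤ) (term-cong k)
    where
    term-cong : ∀ k → term 1ℤ g k ≡ term 1ℤ h k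
    term-cong k with g ≟ k | h ≟ k
    ... | yes _   | yes _   = refl
    ... | yes g≈k | no  h≉k = contradiction (trans (sym g≈h) g≈k) h≉k
    ... | no  g≉k | yes h≈k = contradiction (trans g≈h h≈k) g≉k
    ... | no  _   | no  _   = refl

module _ {c ℓ} {G : Group c ℓ} {σ₁ σ₂ : Group.Carrier G} (K : IsKleinFour G σ₁ σ₂) where

  open Group G
  open IsKleinFour K
  open GroupMorphisms rawGroup (Group.rawGroup ℤ/2×ℤ/2)
  open IsGroupIsomorphism φ-iso using (injective; isGroupHomomorphism)
  open IsGroupHomomorphism isGroupHomomorphism using (homo; ε-homo)
  private module V = Group ℤ/2×ℤ/2

  kleinFour-comm : ∀ g h → g ∙ h ≈ h ∙ g
  kleinFour-comm g h = injective
    (V.trans (homo g h) (V.trans (V-comm (φ g) (φ h)) (V.sym (homo h g))))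
    where
    V-comm : ∀ x y → x V.∙ y V.≈ y V.∙ x
    V-comm (p , q) (p′ , q′) = ℙ.+-comm p p′ , ℙ.+-comm q q′

  kleinFour-involutive : ∀ g → g ∙ g ≈ ε
  kleinFour-involutive g = injective
    -- Negation on parities is the identity, so `V.inverseˡ` already says that `φ g` squares to the
    -- unit.
    (V.trans (homo g g) (V.trans (V.inverseˡ (φ g)) (V.sym ε-homo)))

theorem3 : ∀ {c ℓ m ℓm} (G : Group c ℓ) (σ₁ σ₂ : Group.Carrier G)
    (K : IsKleinFour G σ₁ σ₂)
    (M : LeftModule (IsKleinFour.ℤ[G] K) m ℓm) →
    let open MultiplicativeModule {G = G} {_≟_ = IsKleinFour._≟_ K} M in
    QH90 σ₁ σ₂ →
    (ker ((𝟙 - [ σ₁ ]) * (𝟙 - [ σ₂ ])) ≐ ker (𝟙 - [ σ₁ ]) ∙ˢ ker (𝟙 - [ σ₂ ]))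
    ⇔
    (∀ (m₁ m₂ : ∣M∣) →
    (𝟙 + [ σ₁ ]) · m₁ ≈ᴹ 1ᴹ × (𝟙 + [ σ₂ ]) · m₂ ≈ᴹ 1ᴹ →
    m₁ ∙ᴹ σ₁ ⟨ m₂ ⟩ ≈ᴹ m₂ ∙ᴹ σ₂ ⟨ m₁ ⟩ →
    ∃[ n ] (m₁ ≈ᴹ (𝟙 - [ σ₁ ]) · n × m₂ ≈ᴹ (𝟙 - [ σ₂ ]) · n))
-- [ g ] * [ h ] is definitionally [ g ∙ h ], since 1ℤ * 1ℤ computes to 1ℤ.
theorem3 G σ₁ σ₂ K M (hilbert₁ , hilbert₂) =
  kernelSplits⇔cocyclesHavePreimage M
    ([]-cong G _≟_ (kleinFour-involutive K σ₁))
    ([]-cong G _≟_ (kleinFour-comm K σ₁ σ₂))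
    hilbert₁ hilbert₂
  where open IsKleinFour K using (_≟_)
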